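{- Every $n$-vertex quadrangulation has an edge guard set of size at most $\lfloor n/3 \rfloor$.
   Context: A plane graph is a simple graph together with a crossing-free embedding in $\mathbb{R}^2$. A quadrangulation is a plane graph in which every face (including the outer face) is bounded by a $4$-cycle. For a plane graph $G=(V,E)$, a face $f$ is guarded by an edge $vw \in E$ if at least one of $v,w$ lies on the boundary of $f$. A set $\Gamma \subseteq E$ is an edge guard set if every face of $G$ (including the outer face) is guarded by some edge of $\Gamma$. -}

module Defs where

open import Data.Nat using (ℕ; zero; suc; _+_; _*_)
open import Data.Fin using (Fin)
open import Data.Fin.Permutation using (Permutation′; _⟨$⟩ʳ_)
open import Data.Product using (Σ; ∃; _×_; _,_)
open import Data.Sum using (_⊎_)
open import Data.List using (List)
open import Data.List.Relation.Unary.Any using (Any)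
open import Relation.Binary.PropositionalEquality using (_≡_; _≢_)
open import Relation.Nullary using (¬_)
open import Function.Bundles using (_⇔_)

iter : {A : Set} → (A → A) → ℕ → A → A
iter f zero    x = x
iter f (suc k) x = f (iter f k x)

SameOrbit : {d : ℕ} → Permutation′ d → Fin d → Fin d → Set
SameOrbit π x y = ∃ λ k → iter (π ⟨$⟩ʳ_) k x ≡ y

Surjective : {A B : Set} → (A → B) → Set
Surjective {A} {B} f = (b : B) → ∃ λ a → f a ≡ b

data Reach {d : ℕ} (σ α : Fin d → Fin d) (x : Fin d) : Fin d → Set where
  here  : Reach σ α x x
  stepσ : ∀ {y} → Reach σ α x y → Reach σ α x (σ y)
  stepα : ∀ {y} → Reach σ α x y → Reach σ α x (α y)

-- A connected plane graph, given combinatorially as a genus-0 combinatorial map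
-- (rotation system) on d darts with n vertices (labelled by Fin n) and F faces.
--   σ : rotation of darts around their tail vertex (vertices = σ-orbits)
--   α : fixed-point-free involution pairing the two darts of an edge (edges = α-orbits)
--   φ x = σ (α x) : face permutation (faces = φ-orbits)
record PlaneGraph (n : ℕ) : Set where
  field
    d      : ℕ
    σ      : Permutation′ d
    α      : Fin d → Fin d
    α-inv  : ∀ x → α (α x) ≡ x
    α-free : ∀ x → α x ≢ x
    F      : ℕ
    vertex : Fin d → Fin n
    face   : Fin d → Fin F
  φ : Fin d → Fin d
  φ x = σ ⟨$⟩ʳ α x
  field
    vertex-surj  : Surjective vertex
    vertex-orbit : ∀ x y → (vertex x ≡ vertex y) ⇔ SameOrbit σ x y
    face-surj    : Surjective face
    face-orbit   : ∀ x y → (face x ≡ face y) ⇔ (∃ λ k → iter φ k x ≡ y)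
    connected    : ∀ x y → Reach (σ ⟨$⟩ʳ_) α x y
    -- Euler's formula n - m + F = 2 with m = d / 2 edges (genus 0, i.e. planar embedding)
    euler        : 2 * n + 2 * F ≡ d + 4
    no-loops     : ∀ x → vertex x ≢ vertex (α x)
    no-multi     : ∀ x y → vertex x ≡ vertex y → vertex (α x) ≡ vertex (α y) → x ≡ y

open PlaneGraph public

IsQuadrangulation : {n : ℕ} → PlaneGraph n → Set
IsQuadrangulation G = ∀ x →
    iter φG 4 x ≡ x
  × v (iter φG 0 x) ≢ v (iter φG 1 x) × v (iter φG 0 x) ≢ v (iter φG 2 x)
  × v (iter φG 0 x) ≢ v (iter φG 3 x) × v (iter φG 1 x) ≢ v (iter φG 2 x)
  × v (iter φG 1 x) ≢ v (iter φG 3 x) × v (iter φG 2 x) ≢ v (iter φG 3 x)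
  where
    φG = φ G
    v  = vertex G

OnBoundary : {n : ℕ} (G : PlaneGraph n) → Fin n → Fin (F G) → Set
OnBoundary G u f = ∃ λ y → face G y ≡ f × vertex G y ≡ u

-- face f is guarded by the edge represented by dart e (edge {vertex e, vertex (α e)})
Guards : {n : ℕ} (G : PlaneGraph n) → Fin (F G) → Fin (d G) → Set
Guards G f e = OnBoundary G (vertex G e) f ⊎ OnBoundary G (vertex G (α G e)) f

-- Γ (a list of edges, each given by one of its darts) guards every face
IsEdgeGuardSet : {n : ℕ} (G : PlaneGraph n) → List (Fin (d G)) → Set
IsEdgeGuardSet G Γ = ∀ f → Any (Guards G f) Γ

{-# OPTIONS --safe #-}
module Submission where

-- It suffices to colour the vertices with two colours such that each face has an odd number of
-- vertices of each colour: then it has vertices of both colours and a monochromatic edge.  Take a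
-- maximal matching M of monochromatic edges.  Three sets guard all faces: M itself and, for each
-- colour c, the edges of M of colour c together with one edge at each vertex of colour c that M
-- misses.  Together they have 2|M| + (number of vertices missed by M) ≤ n edges.
--
-- The colouring solves a linear system over F₂ whose only possible obstruction is a set z of oddly
-- many faces with an even number of faces of z at each vertex.  A quadrangulation is bipartite; as
-- diagonals between black vertices, the faces in z have even degree at each black vertex and, being
-- even at the white vertices of the sphere, they form a cut of the graph of black diagonals.  A cut
-- with even degrees has even size, so there is no obstruction.  (This is the argument for Gallai's
-- theorem that the edges of a graph are the disjoint union of a cut and an even subgraph.)
--
-- That H¹ of the sphere vanishes, used for the bipartition and for the cut, follows from Euler's
-- formula by counting: a spanning tree of the dual has F - 1 edges, a cocycle is determined by its
-- values on the remaining n - 1 edges, and the coboundaries already have dimension n - 1.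

open import Defs
open import Algebra.Bundles using (CommutativeRing)
open import Data.Bool using (Bool; true; false; _∧_; _xor_; not; if_then_else_)
open import Data.Bool.Properties
  using (xor-∧-commutativeRing; ∧-distribʳ-xor; ∧-distribˡ-xor; xor-same; xor-assoc; xor-comm;
         xor-identityʳ; not-distribʳ-xor; ∧-zeroʳ; ∧-identityʳ; ∧-idem; ∧-comm; ∧-assoc;
         not-involutive; ¬-not; not-¬; not-injective)
  renaming (_≟_ to _≟ᵇ_)
open import Data.Bool.Solver using (module xor-∧-Solver)
open import Data.Nat using (ℕ; zero; suc; _+_; _*_; _^_; _/_; _≤_; _<_; s≤s; z≤n)
open import Data.Nat.DivMod using (/-monoˡ-≤; m*n/n≡m)
open import Data.Nat.Properties
  using (+-suc; +-identityʳ; +-monoʳ-≤; +-monoˡ-≤; +-mono-≤; +-cancelʳ-≤; *-cancelˡ-≤; *-monoʳ-≤;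
         ^-monoʳ-<; ≤-trans; ≤-refl; ≤-reflexive; ≤-pred; ≤-total; n≤1+n; m≤m+n; module ≤-Reasoning)
open import Data.Nat.Solver using (module +-*-Solver)
open import Data.Fin using (Fin; zero; suc; _≟_; combine; funToFin; finToFun)
open import Data.Fin.Permutation using (_⟨$⟩ʳ_; _⟨$⟩ˡ_; inverseˡ; inverseʳ)
open import Data.Fin.Properties
  using (any?; pigeonhole; injective⇒≤; funToFin-finToFin; finToFun-funToFin; 2↔Bool; <⇒≢)
open import Data.List using (List; []; _∷_; _++_; length; lookup; filter; map)
open import Data.List.Membership.DecPropositional using () renaming (_∈?_ to mem?)
open import Data.List.Membership.Propositional using (_∈_; _∉_; lose)
open import Data.List.Membership.Propositional.Properties using (∈-filter⁺; ∈-allFin)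
open import Data.List.Membership.Setoid.Properties using (index-injective)
open import Data.List.Properties using (filter-notAll; length-filter; length-tabulate; length-++; length-map)
open import Data.List.Relation.Unary.All as All using (All; []; _∷_)
open import Data.List.Relation.Unary.Any as Any using (here; there)
open import Data.List.Relation.Unary.Any.Properties using (lookup-index; ++⁺ˡ; ++⁺ʳ; map⁺)
open import Data.Product using (∃; ∃₂; _×_; _,_; proj₁; proj₂)
open import Data.Sum using (_⊎_; inj₁; inj₂; [_,_]′)
open import Data.Unit using (⊤; tt)
open import Data.Vec.Functional using () renaming (_∷_ to _∷ᵛ_)
open import Function using (_∘_; id; Equivalence; Inverse; mk⇔)
open import Relation.Binary.PropositionalEquality
open import Relation.Nullary using (Dec; yes; no; does; contradiction)
open import Relation.Nullary.Decidable using (dec-true; dec-false; ¬?; _×-dec_; decidable-stable; does-⇔)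
open import Relation.Unary using (Decidable)

open CommutativeRing xor-∧-commutativeRing using (semiring)
open import Algebra.Properties.Semiring.Sum semiring
  using (sum-syntax; sum-cong-≗; sum-replicate-zero; ∑-distrib-+; ∑-comm; ∑-permute; *-distribˡ-sum)

-- Maximal matchings

infix 4 _∈?_
_∈?_ : ∀ {n} (x : Fin n) xs → Dec (x ∈ xs)
_∈?_ = mem? _≟_

infixl 6 _─_
_─_ : ∀ {n} → List (Fin n) → Fin n → List (Fin n)
xs ─ x = filter (λ y → ¬? (y ≟ x)) xs

∈-─⁺ : ∀ {n} {x y : Fin n} {xs} → y ∈ xs → y ≢ x → y ∈ xs ─ x
∈-─⁺ = ∈-filter⁺ (λ y → ¬? (y ≟ _))

length-─ : ∀ {n} {x : Fin n} xs → x ∈ xs → length (xs ─ x) < length xs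
length-─ xs x∈xs = filter-notAll (λ y → ¬? (y ≟ _)) xs (Any.map (λ eq neq → neq (sym eq)) x∈xs)

module _ {k n} (p q : Fin k → Fin n) (p≢q : ∀ e → p e ≢ q e) {P : Fin k → Set} (P? : Decidable P) where

  -- `U` lists the vertices missed so far. Disjointness of the edges enters only through `size`:
  -- each edge pays for two vertices.
  record Matching (M : List (Fin k)) (U : List (Fin n)) : Set where
    field
      size     : (length M + length M) + length U ≤ n
      edges    : All P M
      covering : ∀ v → v ∈ U ⊎ ∃ λ e → e ∈ M × (v ≡ p e ⊎ v ≡ q e)

  open Matching

  Maximal : List (Fin n) → Set
  Maximal U = ∀ e → P e → p e ∈ U → q e ∉ U

  add-edge : ∀ {M U} e → P e → p e ∈ U → q e ∈ U → Matching M U → Matching (e ∷ M) (U ─ p e ─ q e)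
  add-edge {M} {U} e Pe p∈U q∈U m .size = begin
    suc (a + suc a) + c   ≡⟨ cong (λ t → suc (t + c)) (+-suc a a) ⟩
    suc (suc (a + a + c)) ≡⟨ sym (trans (+-suc (a + a) (suc c)) (cong suc (+-suc (a + a) c))) ⟩
    a + a + suc (suc c)   ≤⟨ +-monoʳ-≤ (a + a)
                               (≤-trans (s≤s (length-─ (U ─ p e) (∈-─⁺ q∈U (p≢q e ∘ sym)))) (length-─ U p∈U)) ⟩
    a + a + length U      ≤⟨ size m ⟩
    n                     ∎
    where
    open ≤-Reasoning
    a = length M
    c = length (U ─ p e ─ q e)
  add-edge e Pe p∈U q∈U m .edges = Pe ∷ edges m
  add-edge {U = U} e Pe p∈U q∈U m .covering v with covering m v
  ... | inj₂ (e′ , e′∈M , end) = inj₂ (e′ , there e′∈M , end)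
  ... | inj₁ v∈U with v ≟ p e | v ≟ q e
  ...   | yes v≡p | _       = inj₂ (e , here refl , inj₁ v≡p)
  ...   | no  _   | yes v≡q = inj₂ (e , here refl , inj₂ v≡q)
  ...   | no v≢p  | no v≢q  = inj₁ (∈-─⁺ (∈-─⁺ v∈U v≢p) v≢q)

  -- `s` bounds the recursion, since each added edge shortens `U`.
  extend : ∀ s {M U} → length U ≤ s → Matching M U → ∃₂ λ M′ U′ → Matching M′ U′ × Maximal U′
  extend s {M} {U} U≤s m with any? (λ e → P? e ×-dec (p e ∈? U) ×-dec (q e ∈? U))
  ... | no none = M , U , m , λ e Pe p∈U q∈U → none (e , Pe , p∈U , q∈U)
  extend zero    {U = []} U≤s m | yes (_ , _ , () , _)
  extend (suc s) {U = U} U≤s m | yes (e , Pe , p∈U , q∈U) =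
    extend s (≤-trans (≤-trans (n≤1+n _) (length-─ (U ─ p e) (∈-─⁺ q∈U (p≢q e ∘ sym))))
                      (≤-pred (≤-trans (length-─ U p∈U) U≤s)))
           (add-edge e Pe p∈U q∈U m)

  maximal-matching : ∃₂ λ M U → Matching M U × Maximal U
  maximal-matching = extend n (≤-reflexive (length-tabulate id)) record
    { size = ≤-reflexive (length-tabulate id) ; edges = [] ; covering = inj₁ ∘ ∈-allFin }

-- Linear algebra over F₂

δ : ∀ {n} → Fin n → Fin n → Bool
δ i j = does (i ≟ j)

δ-≡ : ∀ {n} (i : Fin n) → δ i i ≡ true
δ-≡ i = dec-true (i ≟ i) refl

δ-≢ : ∀ {n} {i j : Fin n} → i ≢ j → δ i j ≡ false
δ-≢ {i = i} {j} = dec-false (i ≟ j)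

δ-sym : ∀ {n} (i j : Fin n) → δ i j ≡ δ j i
δ-sym i j = does-⇔ (mk⇔ sym sym) (i ≟ j) (j ≟ i)

∑-δ : ∀ {n} (g : Fin n → Bool) (i : Fin n) → ∑[ j < n ] (g j ∧ δ j i) ≡ g i
∑-δ {suc n} g zero = begin
  (g zero ∧ true) xor ∑[ j < n ] (g (suc j) ∧ false)
    ≡⟨ cong₂ _xor_ (∧-identityʳ (g zero)) (sum-cong-≗ λ j → ∧-zeroʳ (g (suc j))) ⟩
  g zero xor ∑[ j < n ] false  ≡⟨ cong (g zero xor_) (sum-replicate-zero n) ⟩
  g zero xor false             ≡⟨ xor-identityʳ _ ⟩
  g zero                       ∎
  where open ≡-Reasoning
∑-δ {suc n} g (suc i) rewrite ∧-zeroʳ (g zero) = ∑-δ (g ∘ suc) i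

⟨_,_⟩ : ∀ {n} → (Fin n → Bool) → (Fin n → Bool) → Bool
⟨_,_⟩ {n} s a = ∑[ i < n ] (s i ∧ a i)

⟨⟩-+ˡ : ∀ {n} (s t a : Fin n → Bool) → ⟨ (λ i → s i xor t i) , a ⟩ ≡ ⟨ s , a ⟩ xor ⟨ t , a ⟩
⟨⟩-+ˡ s t a = trans (sum-cong-≗ λ i → ∧-distribʳ-xor (a i) (s i) (t i)) (∑-distrib-+ (λ i → s i ∧ a i) _)

⟨⟩-+ʳ : ∀ {n} (s a b : Fin n → Bool) → ⟨ s , (λ i → a i xor b i) ⟩ ≡ ⟨ s , a ⟩ xor ⟨ s , b ⟩
⟨⟩-+ʳ s a b = trans (sum-cong-≗ λ i → ∧-distribˡ-xor (s i) (a i) (b i)) (∑-distrib-+ (λ i → s i ∧ a i) _)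

-- If b is not in the span of the remaining columns but s detects it while not killing
-- the column a, then either a + b is in the span, or a certificate for a + b,
-- possibly added to s, is a certificate for b.
fredholm : ∀ {p} q (A : Fin q → Fin p → Bool) (b : Fin p → Bool) →
  (∃ λ (u : Fin q → Bool) → ∀ i → ∑[ j < q ] (u j ∧ A j i) ≡ b i) ⊎
  (∃ λ (s : Fin p → Bool) → (∀ j → ⟨ s , A j ⟩ ≡ false) × ⟨ s , b ⟩ ≡ true)
fredholm zero A b with any? (λ i → b i ≟ᵇ true)
... | yes (i , bi) = inj₂ ((λ j → δ j i) , (λ ()) , trans (sum-cong-≗ λ j → ∧-comm (δ j i) (b j)) (trans (∑-δ b i) bi))
... | no none = inj₁ ((λ ()) , λ i → sym (¬-not (λ e → none (i , e))))
fredholm (suc q) A b with fredholm q (A ∘ suc) b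
... | inj₁ (u , eq) = inj₁ (false ∷ᵛ u , eq)
... | inj₂ (s , kill , one) with ⟨ s , A zero ⟩ in sa
...   | false = inj₂ (s , (λ { zero → sa ; (suc j) → kill j }) , one)
...   | true with fredholm q (A ∘ suc) (λ i → A zero i xor b i)
...     | inj₁ (u , eq) = inj₁ (true ∷ᵛ u , λ i →
            trans (cong (A zero i xor_) (eq i)) (cancel (A zero i) (b i)))
  where
  cancel : ∀ x y → x xor (x xor y) ≡ y
  cancel x y = trans (sym (xor-assoc x x y)) (cong (_xor y) (xor-same x))
...     | inj₂ (t , kill′ , one′) with ⟨ t , A zero ⟩ in ta | trans (sym (⟨⟩-+ʳ t (A zero) b)) one′
...       | false | tb = inj₂ (t , (λ { zero → ta ; (suc j) → kill′ j }) , tb)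
...       | true | tb = inj₂ ((λ i → s i xor t i) , killˢᵗ ,
              trans (⟨⟩-+ˡ s t b) (cong₂ _xor_ one (not-injective tb)))
  where
  killˢᵗ : ∀ j → ⟨ (λ i → s i xor t i) , A j ⟩ ≡ false
  killˢᵗ zero = trans (⟨⟩-+ˡ s t (A zero)) (cong₂ _xor_ sa ta)
  killˢᵗ (suc j) = trans (⟨⟩-+ˡ s t (A (suc j))) (cong₂ _xor_ (kill j) (kill′ j))

-- Exchange the two sums.
⟨⟩-span : ∀ {p q} (z : Fin p → Bool) (w : Fin q → Bool) (K : Fin q → Fin p → Bool) →
  (∀ j → ⟨ z , K j ⟩ ≡ false) → ⟨ z , (λ i → ∑[ j < q ] (w j ∧ K j i)) ⟩ ≡ false
⟨⟩-span {p} {q} z w K kill = begin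
  ∑[ i < p ] (z i ∧ ∑[ j < q ] (w j ∧ K j i))
    ≡⟨ sum-cong-≗ (λ i → trans (*-distribˡ-sum (z i) (λ j → w j ∧ K j i)) (sum-cong-≗ λ j → swap (z i) (w j) (K j i))) ⟩
  ∑[ i < p ] ∑[ j < q ] (w j ∧ (z i ∧ K j i))
    ≡⟨ ∑-comm (λ i j → w j ∧ (z i ∧ K j i)) ⟩
  ∑[ j < q ] ∑[ i < p ] (w j ∧ (z i ∧ K j i))
    ≡⟨ sum-cong-≗ (λ j → trans (sym (*-distribˡ-sum (w j) (λ i → z i ∧ K j i)))
                            (trans (cong (w j ∧_) (kill j)) (∧-comm (w j) false))) ⟩
  ∑[ j < q ] (false ∧ w j)
    ≡⟨ sym (*-distribˡ-sum false w) ⟩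
  false ∎
  where
  open ≡-Reasoning
  swap : ∀ x y k → x ∧ (y ∧ k) ≡ y ∧ (x ∧ k)
  swap x y k = trans (sym (∧-assoc x y k)) (trans (cong (_∧ k) (∧-comm x y)) (∧-assoc y x k))

-- Pigeonhole for vectors over F₂

open Inverse 2↔Bool using ()
  renaming (to to bit; from to digit; strictlyInverseˡ to bit-digit; strictlyInverseʳ to digit-bit)

decode : ∀ {n} → Fin (2 ^ n) → Fin n → Bool
decode i l = bit (finToFun i l)

encode : ∀ {n} → (Fin n → Bool) → Fin (2 ^ n)
encode g = funToFin (digit ∘ g)

funToFin-cong : ∀ {m n} {f g : Fin m → Fin n} → f ≗ g → funToFin f ≡ funToFin g
funToFin-cong {zero} eq = refl
funToFin-cong {suc m} eq = cong₂ combine (eq zero) (funToFin-cong (eq ∘ suc))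

decode-encode : ∀ {n} (g : Fin n → Bool) → decode (encode g) ≗ g
decode-encode g l = trans (cong bit (finToFun-funToFin (digit ∘ g) l)) (bit-digit (g l))

encode-decode : ∀ {n} (i : Fin (2 ^ n)) → encode {n} (decode i) ≡ i
encode-decode {n} i = trans (funToFin-cong λ l → digit-bit (finToFun {2} {n} i l)) (funToFin-finToFin {n} i)

abstract
  -- There are 2 ^ k inputs and only 2 ^ r outputs. For a linear `Ψ` the sum of the two vectors is a
  -- nonzero element of the kernel.
  collision : ∀ {r k} → r < k → (Ψ : (Fin k → Bool) → Fin r → Bool) →
    ∃₂ λ g g′ → (Ψ g ≗ Ψ g′) × ∃ λ i → g i ≢ g′ i
  collision {r} {k} r<k Ψ
    with i , j , i<j , eq ← pigeonhole (^-monoʳ-< 2 (s≤s (s≤s z≤n)) r<k) (λ i → encode (Ψ (decode i)))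
    with any? (λ l → ¬? (decode {k} i l ≟ᵇ decode j l))
  ... | yes l≢ = decode i , decode j ,
        (λ l → trans (sym (decode-encode _ l)) (trans (cong (λ c → decode c l) eq) (decode-encode _ l))) , l≢
  ... | no none = contradiction (trans (sym (encode-decode {k} i))
        (trans (funToFin-cong λ l → cong digit (decidable-stable (_ ≟ᵇ _) λ l≢ → none (l , l≢))) (encode-decode {k} j)))
        (<⇒≢ i<j)

-- Identities in F₂

xor-≡ : ∀ {x y} → x xor y ≡ false → x ≡ y
xor-≡ {false} eq = sym eq
xor-≡ {true} {true} eq = refl

module _ where
  open xor-∧-Solver

  abstract
    rearrange : ∀ p p′ q q′ r r′ h →
      ((p xor p′) xor (q xor q′)) xor ((r xor r′) ∧ h) ≡
      ((p xor q) xor (r ∧ h)) xor ((p′ xor q′) xor (r′ ∧ h))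
    rearrange = solve 7 (λ p p′ q q′ r r′ h →
      ((p :+ p′) :+ (q :+ q′)) :+ ((r :+ r′) :* h) :=
      ((p :+ q) :+ (r :* h)) :+ ((p′ :+ q′) :+ (r′ :* h))) refl

    -- The `b` terms cancel cyclically; `b₄` is separate because four steps around a face return to
    -- the start only up to a proof.
    telescope : ∀ b₀ b₁ b₂ b₃ z h₀ h₁ h₂ h₃ {b₄} → b₄ ≡ b₀ →
      ((b₀ xor b₁) xor (z ∧ h₀)) xor (((b₁ xor b₂) xor (z ∧ h₁)) xor
        (((b₂ xor b₃) xor (z ∧ h₂)) xor ((b₃ xor b₄) xor (z ∧ h₃)))) ≡
      z ∧ (h₀ xor (h₁ xor (h₂ xor h₃)))
    telescope b₀ b₁ b₂ b₃ z h₀ h₁ h₂ h₃ refl = solve 9 (λ b₀ b₁ b₂ b₃ z h₀ h₁ h₂ h₃ →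
      ((b₀ :+ b₁) :+ z :* h₀) :+ (((b₁ :+ b₂) :+ z :* h₁) :+
        (((b₂ :+ b₃) :+ z :* h₂) :+ ((b₃ :+ b₀) :+ z :* h₃)))
      := z :* (h₀ :+ (h₁ :+ (h₂ :+ h₃)))) refl b₀ b₁ b₂ b₃ z h₀ h₁ h₂ h₃

xor-cong⁴ : ∀ {p q r s p′ q′ r′ s′ : Bool} → p ≡ p′ → q ≡ q′ → r ≡ r′ → s ≡ s′ →
  p xor (q xor (r xor s)) ≡ p′ xor (q′ xor (r′ xor s′))
xor-cong⁴ refl refl refl refl = refl

-- Cocycles of a quadrangulation

module Quadrangulation {n : ℕ} (G : PlaneGraph n) (quad : IsQuadrangulation G) where

  private
    D : Set
    D = Fin (d G)

    s s⁻¹ a ϕ : D → D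
    s = σ G ⟨$⟩ʳ_
    s⁻¹ = σ G ⟨$⟩ˡ_
    a = α G
    ϕ = φ G

    v : D → Fin n
    v = vertex G

    fc : D → Fin (F G)
    fc = face G

  ϕ⁴ : ∀ x → ϕ (ϕ (ϕ (ϕ x))) ≡ x
  ϕ⁴ = proj₁ ∘ quad

  ϕ∘α : ∀ x → ϕ (a x) ≡ s x
  ϕ∘α x = cong s (α-inv G x)

  vertex-σ : ∀ x → v (s x) ≡ v x
  vertex-σ x = sym (Equivalence.from (vertex-orbit G x (s x)) (1 , refl))

  vertex-ϕ : ∀ x → v (ϕ x) ≡ v (a x)
  vertex-ϕ = vertex-σ ∘ a

  face-ϕ : ∀ x → fc (ϕ x) ≡ fc x
  face-ϕ x = sym (Equivalence.from (face-orbit G x (ϕ x)) (1 , refl))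

  face-σ : ∀ x → fc (s x) ≡ fc (a x)
  face-σ x = trans (cong fc (sym (ϕ∘α x))) (face-ϕ (a x))

  -- The sum over the four darts of the face of `x`; `∮-rotate` makes it independent of the starting
  -- dart.
  ∮ : (D → Bool) → D → Bool
  ∮ h x = h x xor (h (ϕ x) xor (h (ϕ (ϕ x)) xor h (ϕ (ϕ (ϕ x)))))

  ∮-cong : ∀ {f g : D → Bool} → f ≗ g → ∮ f ≗ ∮ g
  ∮-cong eq x = xor-cong⁴ (eq x) (eq _) (eq _) (eq _)

  record Cocycle (h : D → Bool) : Set where
    field
      symmetric : ∀ x → h (a x) ≡ h x
      closed    : ∀ x → ∮ h x ≡ false

  open Cocycle

  -- Dual spanning trees and determining sets

  Determining : List D → Set
  Determining R = ∀ h → Cocycle h → (∀ {x} → x ∈ R → h x ≡ false) → ∀ x → h x ≡ false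

  -- The dual edges between the faces in W form a tree when R is obtained by deleting them from
  -- a set of edges; a cocycle vanishing on R is peeled off the leaves of that tree.
  record DualTree (e : ℕ) (W : List (Fin (F G))) (R : List D) : Set where
    field
      determining : Determining R
      outside     : ∀ x → fc x ∉ W → x ∈ R ⊎ a x ∈ R
      bound       : length R + length W ≤ suc e

  open DualTree

  darts-distinct : ∀ x → ϕ x ≢ x × ϕ (ϕ x) ≢ x × ϕ (ϕ (ϕ x)) ≢ x
  darts-distinct x with quad x
  ... | _ , v01 , v02 , v03 , _ = v01 ∘ cong v ∘ sym , v02 ∘ cong v ∘ sym , v03 ∘ cong v ∘ sym

  -- Both darts go, since either may represent the edge in `R`.
  remove : List D → D → List D
  remove R t = R ─ t ─ a t

  length-remove : ∀ R t → t ∈ R ⊎ a t ∈ R → length (remove R t) < length R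
  length-remove R t (inj₁ t∈R) = ≤-trans (s≤s (length-filter (λ y → ¬? (y ≟ _)) (R ─ t))) (length-─ R t∈R)
  length-remove R t (inj₂ at∈R) = ≤-trans (length-─ (R ─ t) (∈-─⁺ at∈R (α-free G t))) (length-filter (λ y → ¬? (y ≟ _)) R)

  -- The face of `t` becomes a leaf of the tree. Its other three edges stay in the set, so
  -- closedness at this face forces a cocycle vanishing on the smaller set to vanish at `t` too.
  grow : ∀ {e W R} → DualTree e W R → ∀ t → fc (a t) ∈ W → fc t ∉ W → DualTree e (fc t ∷ W) (remove R t)
  grow {e} {W} {R} T t at∈W t∉W = record { determining = det ; outside = out ; bound = bnd }
    where
    keep : ∀ x → x ≢ t → x ≢ a t → x ∈ R ⊎ a x ∈ R → x ∈ remove R t ⊎ a x ∈ remove R t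
    keep x x≢t x≢at (inj₁ x∈R) = inj₁ (∈-─⁺ (∈-─⁺ x∈R x≢t) x≢at)
    keep x x≢t x≢at (inj₂ ax∈R) = inj₂ (∈-─⁺ (∈-─⁺ ax∈R
      (λ eq → x≢at (trans (sym (α-inv G x)) (cong a eq))))
      (λ eq → x≢t (trans (sym (α-inv G x)) (trans (cong a eq) (α-inv G t)))))

    out : ∀ x → fc x ∉ fc t ∷ W → x ∈ remove R t ⊎ a x ∈ remove R t
    out x x∉ = keep x (λ eq → x∉ (here (cong fc eq))) (λ eq → x∉ (there (subst (_∈ W) (cong fc (sym eq)) at∈W)))
                 (outside T x (x∉ ∘ there))

    bnd : length (remove R t) + suc (length W) ≤ suc e
    bnd = ≤-trans (≤-reflexive (+-suc _ (length W)))
      (≤-trans (+-monoˡ-≤ (length W) (length-remove R t (outside T t t∉W))) (bound T))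

    det : Determining (remove R t)
    det h c zero-on = determining T h c zero-on′
      where
      vanish : ∀ x → fc x ≡ fc t → x ≢ t → h x ≡ false
      vanish x same x≢t with keep x x≢t (λ eq → t∉W (subst (_∈ W) (trans (cong fc (sym eq)) same) at∈W))
                               (outside T x (t∉W ∘ subst (_∈ W) same))
      ... | inj₁ x∈ = zero-on x∈
      ... | inj₂ ax∈ = trans (sym (symmetric c x)) (zero-on ax∈)

      ht : h t ≡ false
      ht with darts-distinct t
      ... | ne₁ , ne₂ , ne₃ = begin
        h t           ≡⟨ xor-identityʳ (h t) ⟨
        h t xor false ≡⟨ cong (h t xor_) (cong₂ _xor_ (vanish (ϕ t) f₁ ne₁)
                           (cong₂ _xor_ (vanish (ϕ (ϕ t)) f₂ ne₂) (vanish (ϕ (ϕ (ϕ t))) f₃ ne₃))) ⟨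
        ∮ h t         ≡⟨ closed c t ⟩
        false         ∎
        where
        open ≡-Reasoning
        f₁ = face-ϕ t
        f₂ = trans (face-ϕ (ϕ t)) f₁
        f₃ = trans (face-ϕ (ϕ (ϕ t))) f₂

      zero-on′ : ∀ {x} → x ∈ R → h x ≡ false
      zero-on′ {x} x∈R with x ≟ t | x ≟ a t
      ... | yes refl | _        = ht
      ... | no _     | yes refl = trans (symmetric c t) ht
      ... | no x≢t   | no x≢at  = zero-on (∈-─⁺ (∈-─⁺ x∈R x≢t) x≢at)

  all-faces-bound : ∀ {W : List (Fin (F G))} → (∀ f → f ∈ W) → F G ≤ length W
  all-faces-bound all∈ = injective⇒≤ {f = Any.index ∘ all∈} λ {f} {g} → index-injective (setoid _) (all∈ f) (all∈ g)

  -- Match the darts along the pairs `x`, `a x`: maximality picks a dart of every edge, and the size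
  -- bound gives the count.
  edges-of-G : ∃ λ (E : List D) → (∀ x → x ∈ E ⊎ a x ∈ E) × length E + length E ≤ d G
  edges-of-G with maximal-matching id a (λ x → α-free G x ∘ sym) {λ _ → ⊤} (λ _ → yes tt)
  ... | E , U , m , maximal = E , cover , ≤-trans (m≤m+n _ _) (Matching.size m)
    where
    cover : ∀ x → x ∈ E ⊎ a x ∈ E
    cover x with Matching.covering m x
    ... | inj₂ (e , e∈E , inj₁ refl) = inj₁ e∈E
    ... | inj₂ (e , e∈E , inj₂ refl) = inj₂ (subst (_∈ E) (sym (α-inv G e)) e∈E)
    ... | inj₁ x∈U with Matching.covering m (a x)
    ...   | inj₁ ax∈U = contradiction ax∈U (maximal x tt x∈U)
    ...   | inj₂ (e , e∈E , inj₁ refl) = inj₂ e∈E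
    ...   | inj₂ (e , e∈E , inj₂ eq) = inj₁ (subst (_∈ E) (trans (sym (α-inv G e)) (trans (cong a (sym eq)) (α-inv G x))) e∈E)

  -- γ zero is the coefficient of h, γ (suc w) that of the coboundary of the indicator of w.
  relation : (D → Bool) → (Fin (suc n) → Bool) → D → Bool
  relation h γ x = (γ (suc (v x)) xor γ (suc (v (a x)))) xor (γ zero ∧ h x)

  relation-linear : ∀ h γ γ′ x → relation h (λ i → γ i xor γ′ i) x ≡ relation h γ x xor relation h γ′ x
  relation-linear h γ γ′ x =
    rearrange (γ (suc (v x))) (γ′ (suc (v x))) (γ (suc (v (a x)))) (γ′ (suc (v (a x)))) (γ zero) (γ′ zero) (h x)

  -- The head of a dart is the tail of its ϕ-successor, so the coboundary part telescopes around
  -- each face.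
  relation-cocycle : ∀ {h} γ → Cocycle h → Cocycle (relation h γ)
  relation-cocycle {h} γ c .symmetric x rewrite α-inv G x | symmetric c x =
    cong (_xor (γ zero ∧ h x)) (xor-comm (γ (suc (v (a x)))) _)
  relation-cocycle {h} γ c .closed x = begin
    ∮ (relation h γ) x
      ≡⟨ ∮-cong (λ y → cong (λ w → (B y xor γ (suc w)) xor (γ zero ∧ h y)) (sym (vertex-ϕ y))) x ⟩
    ∮ (λ y → (B y xor B (ϕ y)) xor (γ zero ∧ h y)) x
      ≡⟨ telescope (B x) (B (ϕ x)) (B (ϕ (ϕ x))) (B (ϕ (ϕ (ϕ x)))) (γ zero)
           (h x) (h (ϕ x)) (h (ϕ (ϕ x))) (h (ϕ (ϕ (ϕ x)))) (cong B (ϕ⁴ x)) ⟩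
    γ zero ∧ ∮ h x
      ≡⟨ cong (γ zero ∧_) (closed c x) ⟩
    γ zero ∧ false
      ≡⟨ ∧-zeroʳ (γ zero) ⟩
    false ∎
    where
    open ≡-Reasoning
    B : D → Bool
    B y = γ (suc (v y))

  -- Vanishing of H¹ by counting

  module _ (root : D) where

    -- Each tree edge shortens `R`, so `k` bounds the recursion. Once no edge leaves `W`,
    -- connectedness puts every face in `W`, because `s x` lies on the face across the edge of `x`.
    spanning : ∀ k {e W R} → length R ≤ k → fc root ∈ W → DualTree e W R →
      ∃ λ R′ → Determining R′ × length R′ + F G ≤ suc e
    spanning k {e} {W} {R} R≤k r∈W T with any? (λ t → (fc (a t) ∈? W) ×-dec ¬? (fc t ∈? W))
    ... | no none = R , determining T , ≤-trans (+-monoʳ-≤ (length R) (all-faces-bound all∈)) (bound T)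
      where
      cross : ∀ {y} → fc y ∈ W → fc (a y) ∈ W
      cross {y} y∈W = decidable-stable (_ ∈? W) λ ay∉W →
        none (a y , subst (_∈ W) (cong fc (sym (α-inv G y))) y∈W , ay∉W)

      reach : ∀ {y} → Reach s a root y → fc y ∈ W
      reach here = r∈W
      reach (stepσ r) = subst (_∈ W) (sym (face-σ _)) (cross (reach r))
      reach (stepα r) = cross (reach r)

      all∈ : ∀ f → f ∈ W
      all∈ f with face-surj G f
      ... | y , refl = reach (connected G root y)
    spanning zero {R = []} R≤k r∈W T | yes (t , at∈W , t∉W) with outside T t t∉W
    ... | inj₁ ()
    ... | inj₂ ()
    spanning (suc k) {R = R} R≤k r∈W T | yes (t , at∈W , t∉W) =
      spanning k (≤-pred (≤-trans (length-remove R t (outside T t t∉W)) R≤k)) (there r∈W) (grow T t at∈W t∉W)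

    abstract
      -- Start from one face and all edges `E`. In the end |R| + F ≤ |E| + 1, and 2|E| ≤ d turns
      -- Euler's formula into |R| + 1 ≤ n.
      small-determining-set : ∃ λ R → Determining R × length R < n
      small-determining-set with edges-of-G
      ... | E , cover , 2E≤d with spanning (length E) {W = fc root ∷ []} ≤-refl (here refl) (record
              { determining = λ h c zero-on x → [ zero-on , (λ ax∈ → trans (sym (symmetric c x)) (zero-on ax∈)) ]′ (cover x)
              ; outside = λ x _ → cover x
              ; bound = ≤-reflexive (trans (+-suc (length E) 0) (cong suc (+-identityʳ _))) })
      ...   | R , det , R+F≤e+1 = R , det , *-cancelˡ-≤ 2 (+-cancelʳ-≤ (2 * F G) _ _ count)
        where
        open ≤-Reasoning
        open +-*-Solver
        count : 2 * suc (length R) + 2 * F G ≤ 2 * n + 2 * F G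
        count = begin
          2 * suc (length R) + 2 * F G ≡⟨ solve 2 (λ r f → con 2 :* (con 1 :+ r) :+ con 2 :* f :=
                                                     con 2 :+ con 2 :* (r :+ f)) refl (length R) (F G) ⟩
          2 + 2 * (length R + F G)     ≤⟨ +-monoʳ-≤ 2 (*-monoʳ-≤ 2 R+F≤e+1) ⟩
          2 + 2 * suc (length E)       ≡⟨ solve 1 (λ e → con 2 :+ con 2 :* (con 1 :+ e) :=
                                                   (e :+ e) :+ con 4) refl (length E) ⟩
          length E + length E + 4      ≤⟨ +-monoˡ-≤ 4 2E≤d ⟩
          d G + 4                      ≡⟨ euler G ⟨
          2 * n + 2 * F G              ∎

    constant : ∀ (g : Fin n → Bool) → (∀ x → g (v x) ≡ g (v (a x))) → ∀ w → g w ≡ g (v root)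
    constant g across w with vertex-surj G w
    ... | y , refl = reach (connected G root y)
      where
      reach : ∀ {y} → Reach s a root y → g (v y) ≡ g (v root)
      reach here = refl
      reach (stepσ {y} r) = trans (cong g (vertex-σ y)) (reach r)
      reach (stepα {y} r) = trans (sym (across y)) (reach r)

    -- h and the coboundaries of the n vertex indicators are n + 1 vectors; on a determining set, with the
    -- extra condition that the coefficient of the root vertex vanishes, they satisfy at most n equations.
    Relation : (D → Bool) → Set
    Relation h = ∃ λ γ → (∀ x → relation h γ x ≡ false) × γ (suc (v root)) ≡ false × ∃ λ i → γ i ≡ true

    difference : ∀ {h R γ γ′} → Cocycle h → Determining R →
      (∀ {x} → x ∈ R → relation h γ x ≡ relation h γ′ x) → γ (suc (v root)) ≡ γ′ (suc (v root)) →
      (∃ λ i → γ i ≢ γ′ i) → Relation h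
    difference {h} {R} {γ} {γ′} c det same same-root (i , differ) =
      β , det (relation h β) (relation-cocycle β c) on-R , cancel same-root , i , ¬-not (differ ∘ xor-≡)
      where
      β : Fin (suc n) → Bool
      β j = γ j xor γ′ j

      cancel : ∀ {x y} → x ≡ y → x xor y ≡ false
      cancel {x} refl = xor-same x

      on-R : ∀ {x} → x ∈ R → relation h β x ≡ false
      on-R {x} x∈R = trans (relation-linear h γ γ′ x) (cancel (same x∈R))

    abstract
      linear-relation : ∀ h → Cocycle h → Relation h
      linear-relation h c =
        let R , det , R<n = small-determining-set
            -- The head coordinate imposes the root condition, the others the values on `R`: |R| + 1
            -- < n + 1.
            γ , γ′ , same , differ = collision (s≤s R<n) (λ γ → γ (suc (v root)) ∷ᵛ (relation h γ ∘ lookup R))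
        in difference c det
             (λ x∈R → subst (λ y → relation h γ y ≡ relation h γ′ y) (sym (lookup-index x∈R)) (same (suc (Any.index x∈R))))
             (same zero) differ

    -- If `h` has coefficient 1 in the relation, the relation expresses it as a coboundary.
    -- Otherwise the vertex coefficients agree along edges, hence equal the zero at the root, and
    -- the relation is trivial.
    coboundary : ∀ h → Cocycle h → ∃ λ (g : Fin n → Bool) → ∀ x → h x ≡ g (v x) xor g (v (a x))
    coboundary h c with linear-relation h c
    ... | γ , zeros , root-zero , i , γi with γ zero in γ₀
    ...   | true = γ ∘ suc , λ x → sym (xor-≡ (zeros x))
    ...   | false = contradiction γi (not-¬ (all-zero i))
      where
      all-zero : ∀ i → γ i ≡ false
      all-zero zero    = γ₀
      all-zero (suc w) =
        trans (constant (γ ∘ suc) (λ x → xor-≡ (trans (sym (xor-identityʳ _)) (zeros x))) w) root-zero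

    -- The constant 1 is a cocycle because the faces have even length.
    bipartition : ∃ λ (b : Fin n → Bool) → ∀ x → b (v x) ≡ not (b (v (a x)))
    bipartition with coboundary (λ _ → true) (record { symmetric = λ _ → refl ; closed = λ _ → refl })
    ... | b , eq = b , λ x → xor-≡ (trans (sym (not-distribʳ-xor (b (v x)) (b (v (a x))))) (cong not (sym (eq x))))

  -- The parity of a colouring on the faces

  open ≡-Reasoning

  -- For `t = v` this says that the vertex-face incidence matrix sends a colouring to its face
  -- parities.
  ∑-∮ : ∀ {m} (w : Fin m → Bool) (t : D → Fin m) x → ∑[ j < m ] (w j ∧ ∮ (δ j ∘ t) x) ≡ ∮ (w ∘ t) x
  ∑-∮ {m} w t x = begin
    ∑[ j < m ] (w j ∧ ∮ (δ j ∘ t) x)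
      ≡⟨ split (δ₀ x) (λ j → δ₀ (ϕ x) j xor (δ₀ (ϕ (ϕ x)) j xor δ₀ (ϕ (ϕ (ϕ x))) j)) ⟩
    ⟨ w , δ₀ x ⟩ xor ⟨ w , (λ j → δ₀ (ϕ x) j xor (δ₀ (ϕ (ϕ x)) j xor δ₀ (ϕ (ϕ (ϕ x))) j)) ⟩
      ≡⟨ cong₂ _xor_ (at x) (split (δ₀ (ϕ x)) (λ j → δ₀ (ϕ (ϕ x)) j xor δ₀ (ϕ (ϕ (ϕ x))) j)) ⟩
    w (t x) xor (⟨ w , δ₀ (ϕ x) ⟩ xor ⟨ w , (λ j → δ₀ (ϕ (ϕ x)) j xor δ₀ (ϕ (ϕ (ϕ x))) j) ⟩)
      ≡⟨ cong (w (t x) xor_) (cong₂ _xor_ (at (ϕ x))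
           (trans (split (δ₀ (ϕ (ϕ x))) (δ₀ (ϕ (ϕ (ϕ x))))) (cong₂ _xor_ (at (ϕ (ϕ x))) (at (ϕ (ϕ (ϕ x))))))) ⟩
    ∮ (w ∘ t) x ∎
    where
    δ₀ : D → Fin m → Bool
    δ₀ y j = δ j (t y)
    split = ⟨⟩-+ʳ w
    at : ∀ y → ⟨ w , δ₀ y ⟩ ≡ w (t y)
    at y = ∑-δ w (t y)

  -- Darts of a face and double counting

  rep : Fin (F G) → D
  rep f = proj₁ (face-surj G f)

  face-rep : ∀ f → fc (rep f) ≡ f
  face-rep f = proj₂ (face-surj G f)

  data OnFace (x : D) : D → Set where
    i₀ : OnFace x x
    i₁ : OnFace x (ϕ x)
    i₂ : OnFace x (ϕ (ϕ x))
    i₃ : OnFace x (ϕ (ϕ (ϕ x)))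

  onFace-iter : ∀ k x → OnFace x (iter ϕ k x)
  onFace-iter zero x = i₀
  onFace-iter (suc k) x with iter ϕ k x | onFace-iter k x
  ... | _ | i₀ = i₁
  ... | _ | i₁ = i₂
  ... | _ | i₂ = i₃
  ... | _ | i₃ = subst (OnFace x) (sym (ϕ⁴ x)) i₀

  face-onFace : ∀ {x y} → OnFace x y → fc y ≡ fc x
  face-onFace i₀ = refl
  face-onFace {x} i₁ = face-ϕ x
  face-onFace {x} i₂ = trans (face-ϕ _) (face-ϕ x)
  face-onFace {x} i₃ = trans (face-ϕ _) (trans (face-ϕ _) (face-ϕ x))

  onFace : ∀ {x y} → fc x ≡ fc y → OnFace x y
  onFace {x} {y} eq with Equivalence.to (face-orbit G x y) eq
  ... | k , refl = onFace-iter k x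

  ∮-rotate : ∀ h x → ∮ h (ϕ x) ≡ ∮ h x
  ∮-rotate h x rewrite ϕ⁴ x = rotate (h x) (h (ϕ x)) (h (ϕ (ϕ x))) (h (ϕ (ϕ (ϕ x))))
    where
    rotate : ∀ p q r s → q xor (r xor (s xor p)) ≡ p xor (q xor (r xor s))
    rotate p q r s = trans (cong (q xor_) (sym (xor-assoc r s p))) (trans (sym (xor-assoc q (r xor s) p)) (xor-comm _ p))

  ∮-invariant : ∀ h {x y} → OnFace x y → ∮ h y ≡ ∮ h x
  ∮-invariant h i₀ = refl
  ∮-invariant h {x} i₁ = ∮-rotate h x
  ∮-invariant h {x} i₂ = trans (∮-rotate h _) (∮-rotate h x)
  ∮-invariant h {x} i₃ = trans (∮-rotate h _) (trans (∮-rotate h _) (∮-rotate h x))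

  -- The four darts of a face are distinct, so `x` is hit exactly once on its own face.
  face-indicator : ∀ x y → ∮ (δ x) y ≡ δ (fc y) (fc x)
  face-indicator x y with fc y ≟ fc x
  ... | yes same = trans (sym (∮-invariant (δ x) (onFace same))) (begin
      ∮ (δ x) x ≡⟨ xor-cong⁴ (δ-≡ x) (δ-≢ (ne₁ ∘ sym)) (δ-≢ (ne₂ ∘ sym)) (δ-≢ (ne₃ ∘ sym)) ⟩
      true ∎)
    where
    ne₁ = proj₁ (darts-distinct x)
    ne₂ = proj₁ (proj₂ (darts-distinct x))
    ne₃ = proj₂ (proj₂ (darts-distinct x))
  ... | no other = xor-cong⁴ (off i₀) (off i₁) (off i₂) (off i₃)
    where
    off : ∀ {z} → OnFace y z → δ x z ≡ false
    off {z} on = δ-≢ {i = x} {z} λ { refl → other (sym (face-onFace on)) }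

  ∑-faces : ∀ (g : D → Bool) → ∑[ f < F G ] ∮ g (rep f) ≡ ∑[ x < d G ] g x
  ∑-faces g = begin
    ∑[ f < F G ] ∮ g (rep f)
      ≡⟨ sum-cong-≗ (λ f → sym (∑-∮ g id (rep f))) ⟩
    ∑[ f < F G ] ∑[ x < d G ] (g x ∧ ∮ (δ x) (rep f))
      ≡⟨ sum-cong-≗ (λ f → sum-cong-≗ λ x → cong (g x ∧_)
           (trans (face-indicator x (rep f)) (cong (λ f → δ f (fc x)) (face-rep f)))) ⟩
    ∑[ f < F G ] ∑[ x < d G ] (g x ∧ δ f (fc x))
      ≡⟨ ∑-comm (λ f x → g x ∧ δ f (fc x)) ⟩
    ∑[ x < d G ] ∑[ f < F G ] (g x ∧ δ f (fc x))
      ≡⟨ sum-cong-≗ (λ x → ∑-δ (λ _ → g x) (fc x)) ⟩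
    ∑[ x < d G ] g x ∎

  -- Sets of faces even at every vertex

  EvenAtVertices : (Fin (F G) → Bool) → Set
  EvenAtVertices z = ∀ (w : Fin n → Bool) → ∑[ x < d G ] (z (fc x) ∧ w (v x)) ≡ false

  -- Group the darts by faces, where `z` is constant; the hypothesis on single vertices extends to
  -- all weights by linearity.
  evenAtVertices : ∀ z → (∀ j → ⟨ z , (λ f → ∮ (δ j ∘ v) (rep f)) ⟩ ≡ false) → EvenAtVertices z
  evenAtVertices z kill w = begin
    ∑[ x < d G ] (z (fc x) ∧ w (v x))
      ≡⟨ sym (∑-faces (λ x → z (fc x) ∧ w (v x))) ⟩
    ∑[ f < F G ] ∮ (λ x → z (fc x) ∧ w (v x)) (rep f)
      ≡⟨ sum-cong-≗ factor ⟩
    ⟨ z , (λ f → ∮ (w ∘ v) (rep f)) ⟩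
      ≡⟨ sum-cong-≗ (λ f → cong (z f ∧_) (sym (∑-∮ w v (rep f)))) ⟩
    ⟨ z , (λ f → ∑[ j < n ] (w j ∧ ∮ (δ j ∘ v) (rep f))) ⟩
      ≡⟨ ⟨⟩-span z w (λ j f → ∮ (δ j ∘ v) (rep f)) kill ⟩
    false ∎
    where
    ∧-∮ : ∀ c (h : D → Bool) x → c ∧ ∮ h x ≡ ∮ (λ y → c ∧ h y) x
    ∧-∮ false h x = refl
    ∧-∮ true  h x = refl

    factor : ∀ f → ∮ (λ x → z (fc x) ∧ w (v x)) (rep f) ≡ z f ∧ ∮ (w ∘ v) (rep f)
    factor f = trans (xor-cong⁴ (at i₀) (at i₁) (at i₂) (at i₃)) (sym (∧-∮ (z f) (w ∘ v) (rep f)))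
      where
      at : ∀ {y} → OnFace (rep f) y → z (fc y) ∧ w (v y) ≡ z f ∧ w (v y)
      at {y} on = cong (λ g → z g ∧ w (v y)) (trans (face-onFace on) (face-rep f))

  -- A certificate against solvability is constant on the darts at each vertex, so evenness at the
  -- vertices excludes it.
  corner-potential : ∀ z → EvenAtVertices z → ∃ λ (p : D → Bool) → ∀ x → p x xor p (s x) ≡ z (fc (s x))
  corner-potential z even with fredholm (d G) (λ j x → δ j x xor δ j (s x)) (λ x → z (fc (s x)))
  ... | inj₁ (p , eq) = p , λ x →
      trans (sym (trans (⟨⟩-+ʳ p (λ j → δ j x) (λ j → δ j (s x))) (cong₂ _xor_ (∑-δ p x) (∑-δ p (s x))))) (eq x)
  ... | inj₂ (ζ , kill , one) = contradiction (trans (sym one) (begin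
      ∑[ x < d G ] (ζ x ∧ z (fc (s x)))
        ≡⟨ sum-cong-≗ (λ x → trans (cong (_∧ z (fc (s x))) (sym (invariant x))) (∧-comm (ζ (s x)) (z (fc (s x))))) ⟩
      ∑[ x < d G ] (z (fc (s x)) ∧ ζ (s x)) ≡⟨ sym (∑-permute (λ x → z (fc x) ∧ ζ x) (σ G)) ⟩
      ∑[ x < d G ] (z (fc x) ∧ ζ x)         ≡⟨ sum-cong-≗ (λ x → cong (z (fc x) ∧_) (at-vertex x)) ⟩
      ∑[ x < d G ] (z (fc x) ∧ w (v x))     ≡⟨ even w ⟩
      false ∎)) λ ()
    where
    δ-s : ∀ j x → δ j (s x) ≡ δ x (s⁻¹ j)
    δ-s j x = does-⇔ (mk⇔ (λ { refl → sym (inverseˡ (σ G)) }) (λ { refl → sym (inverseʳ (σ G)) })) (j ≟ s x) (x ≟ s⁻¹ j)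

    killed : ∀ j → ζ j xor ζ (s⁻¹ j) ≡ false
    killed j = begin
      ζ j xor ζ (s⁻¹ j)
        ≡⟨ cong₂ _xor_ (sym (∑-δ ζ j)) (sym (∑-δ ζ (s⁻¹ j))) ⟩
      ⟨ ζ , (λ x → δ x j) ⟩ xor ⟨ ζ , (λ x → δ x (s⁻¹ j)) ⟩
        ≡⟨ cong₂ _xor_ (sum-cong-≗ λ x → cong (ζ x ∧_) (δ-sym x j)) (sum-cong-≗ λ x → cong (ζ x ∧_) (sym (δ-s j x))) ⟩
      ⟨ ζ , δ j ⟩ xor ⟨ ζ , (λ x → δ j (s x)) ⟩
        ≡⟨ ⟨⟩-+ʳ ζ (δ j) (λ x → δ j (s x)) ⟨
      ⟨ ζ , (λ x → δ j x xor δ j (s x)) ⟩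
        ≡⟨ kill j ⟩
      false ∎

    invariant : ∀ x → ζ (s x) ≡ ζ x
    invariant x = trans (xor-≡ (killed (s x))) (cong ζ (inverseˡ (σ G)))

    w : Fin n → Bool
    w u = ζ (proj₁ (vertex-surj G u))

    at-vertex : ∀ x → ζ x ≡ w (v x)
    at-vertex x with Equivalence.to (vertex-orbit G _ x) (proj₂ (vertex-surj G (v x)))
    ... | k , eq = trans (cong ζ (sym eq)) (along k)
      where
      along : ∀ k → ζ (iter s k (proj₁ (vertex-surj G (v x)))) ≡ w (v x)
      along zero = refl
      along (suc k) = trans (invariant _) (along k)

  -- The black vertices of the introduction are those with `b` false. `h` takes on each edge the
  -- value of `p` at the other end. A face has two corners with `b` true, each contributing its `z`,
  -- so `h` is closed and has a potential `c`. The faces in `z` are those whose black diagonal is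
  -- cut by `c`; `w` keeps `c` on black vertices only.
  face-values : D → ∀ (b : Fin n → Bool) (p : D → Bool) (z : Fin (F G) → Bool) →
    (∀ x → b (v x) ≡ not (b (v (a x)))) → (∀ x → p x xor p (s x) ≡ z (fc (s x))) →
    ∃ λ (w : Fin n → Bool) → ∀ x → z (fc x) ≡ ∮ (w ∘ v) x
  face-values root b p z bipartite corner-p = w , values
    where
    h : D → Bool
    h x = if b (v x) then p x else p (a x)

    flip : ∀ x → b (v (ϕ x)) ≡ not (b (v x))
    flip x = trans (cong b (vertex-ϕ x)) (trans (sym (not-involutive _)) (cong not (sym (bipartite x))))

    white : ∀ x → b (v x) ≡ false ⊎ b (v (ϕ x)) ≡ false
    white x with b (v x) | flip x
    ... | false | _ = inj₁ refl
    ... | true  | e = inj₂ e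

    h-symmetric : ∀ x → h (a x) ≡ h x
    h-symmetric x with b (v x) | b (v (a x)) | bipartite x
    ... | true  | false | _ = cong p (α-inv G x)
    ... | false | true  | _ = refl

    -- `ϕ x` follows `a x` in the rotation at a vertex with `b` true, so `p` changes there by `z` of
    -- the face.
    corner : ∀ x → b (v x) ≡ false → h x xor h (ϕ x) ≡ z (fc x)
    corner x bx rewrite flip x | bx = trans (corner-p (a x)) (cong z (face-ϕ x))

    flip² : ∀ x → b (v x) ≡ false → b (v (ϕ (ϕ x))) ≡ false
    flip² x bx = trans (flip (ϕ x)) (trans (cong not (flip x)) (trans (not-involutive _) bx))

    closed-false : ∀ x → b (v x) ≡ false → ∮ h x ≡ false
    closed-false x bx = begin
      h x xor (h (ϕ x) xor (h (ϕ (ϕ x)) xor h (ϕ (ϕ (ϕ x)))))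
        ≡⟨ xor-assoc (h x) (h (ϕ x)) _ ⟨
      (h x xor h (ϕ x)) xor (h (ϕ (ϕ x)) xor h (ϕ (ϕ (ϕ x))))
        ≡⟨ cong₂ _xor_ (corner x bx) (trans (corner (ϕ (ϕ x)) (flip² x bx)) (cong z (face-onFace i₂))) ⟩
      z (fc x) xor z (fc x)
        ≡⟨ xor-same (z (fc x)) ⟩
      false ∎

    h-closed : ∀ x → ∮ h x ≡ false
    h-closed x with white x
    ... | inj₁ bx = closed-false x bx
    ... | inj₂ bϕx = trans (sym (∮-rotate h x)) (closed-false (ϕ x) bϕx)

    potential : ∃ λ (c : Fin n → Bool) → ∀ x → h x ≡ c (v x) xor c (v (a x))
    potential = coboundary root h (record { symmetric = h-symmetric ; closed = h-closed })

    c w : Fin n → Bool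
    c = proj₁ potential
    w u = if b u then false else c u

    diagonal : ∀ x → b (v x) ≡ false → z (fc x) ≡ c (v x) xor c (v (ϕ (ϕ x)))
    diagonal x bx = begin
      z (fc x)
        ≡⟨ corner x bx ⟨
      h x xor h (ϕ x)
        ≡⟨ cong₂ _xor_ (step x) (step (ϕ x)) ⟩
      (c (v x) xor c (v (ϕ x))) xor (c (v (ϕ x)) xor c (v (ϕ (ϕ x))))
        ≡⟨ xor-cancel-middle (c (v x)) (c (v (ϕ x))) _ ⟩
      c (v x) xor c (v (ϕ (ϕ x))) ∎
      where
      step : ∀ y → h y ≡ c (v y) xor c (v (ϕ y))
      step y = trans (proj₂ potential y) (cong (λ u → c (v y) xor c u) (sym (vertex-ϕ y)))

      xor-cancel-middle : ∀ p q r → (p xor q) xor (q xor r) ≡ p xor r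
      xor-cancel-middle p q r = trans (xor-assoc p q _)
        (cong (p xor_) (trans (sym (xor-assoc q q r)) (cong (_xor r) (xor-same q))))

    values-false : ∀ x → b (v x) ≡ false → z (fc x) ≡ ∮ (w ∘ v) x
    values-false x bx = begin
      z (fc x)                                     ≡⟨ diagonal x bx ⟩
      c (v x) xor c (v (ϕ (ϕ x)))                  ≡⟨ cong (c (v x) xor_) (xor-identityʳ _) ⟨
      c (v x) xor (false xor (c (v (ϕ (ϕ x))) xor false))
        ≡⟨ xor-cong⁴ (at-false x bx) (at-true (ϕ x) (trans (flip x) (cong not bx)))
             (at-false (ϕ (ϕ x)) (flip² x bx)) (at-true (ϕ (ϕ (ϕ x))) (trans (flip (ϕ (ϕ x))) (cong not (flip² x bx)))) ⟨
      ∮ (w ∘ v) x ∎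
      where
      at-false : ∀ y → b (v y) ≡ false → w (v y) ≡ c (v y)
      at-false y by rewrite by = refl

      at-true : ∀ y → b (v y) ≡ true → w (v y) ≡ false
      at-true y by rewrite by = refl

    values : ∀ x → z (fc x) ≡ ∮ (w ∘ v) x
    values x with white x
    ... | inj₁ bx = values-false x bx
    ... | inj₂ bϕx = begin
      z (fc x)         ≡⟨ cong z (sym (face-ϕ x)) ⟩
      z (fc (ϕ x))     ≡⟨ values-false (ϕ x) bϕx ⟩
      ∮ (w ∘ v) (ϕ x)  ≡⟨ ∮-rotate (w ∘ v) x ⟩
      ∮ (w ∘ v) x      ∎

  -- An obstruction `z` is orthogonal to all columns, yet by `face-values` it is itself a
  -- combination of them. So it is orthogonal to itself, and over F₂ this means that it has even
  -- size.
  odd-colouring : D → ∃ λ (u : Fin n → Bool) → ∀ f → ∮ (u ∘ v) (rep f) ≡ true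
  odd-colouring root with fredholm n (λ j f → ∮ (δ j ∘ v) (rep f)) (λ _ → true)
  ... | inj₁ (u , eq) = u , λ f → trans (sym (∑-∮ u v (rep f))) (eq f)
  ... | inj₂ (z , kill , one) = contradiction (trans (sym one) even-sum) λ ()
    where
    even : EvenAtVertices z
    even = evenAtVertices z kill

    values : ∃ λ (w : Fin n → Bool) → ∀ x → z (fc x) ≡ ∮ (w ∘ v) x
    values =
      let b , bipartite = bipartition root
          p , corner = corner-potential z even
      in face-values root b p z bipartite corner

    w : Fin n → Bool
    w = proj₁ values

    even-sum : ⟨ z , (λ _ → true) ⟩ ≡ false
    even-sum = begin
      ∑[ f < F G ] (z f ∧ true)
        ≡⟨ sum-cong-≗ (λ f → trans (∧-identityʳ (z f)) (sym (∧-idem (z f)))) ⟩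
      ∑[ f < F G ] (z f ∧ z f)
        ≡⟨ sum-cong-≗ (λ f → cong (z f ∧_) (trans (cong z (sym (face-rep f))) (proj₂ values (rep f)))) ⟩
      ⟨ z , (λ f → ∮ (w ∘ v) (rep f)) ⟩
        ≡⟨ sum-cong-≗ (λ f → cong (z f ∧_) (sym (∑-∮ w v (rep f)))) ⟩
      ⟨ z , (λ f → ∑[ j < n ] (w j ∧ ∮ (δ j ∘ v) (rep f))) ⟩
        ≡⟨ ⟨⟩-span z w (λ j f → ∮ (δ j ∘ v) (rep f)) kill ⟩
      false ∎

  -- If `c` is missed, four equal values sum to zero.
  odd-attains : ∀ h x → ∮ h x ≡ true → ∀ c → ∃ λ y → OnFace x y × h y ≡ c
  odd-attains h x odd c
    with h x ≟ᵇ c | h (ϕ x) ≟ᵇ c | h (ϕ (ϕ x)) ≟ᵇ c | h (ϕ (ϕ (ϕ x))) ≟ᵇ c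
  ... | yes e | _     | _     | _     = _ , i₀ , e
  ... | no _  | yes e | _     | _     = _ , i₁ , e
  ... | no _  | no _  | yes e | _     = _ , i₂ , e
  ... | no _  | no _  | no _  | yes e = _ , i₃ , e
  ... | no e₀ | no e₁ | no e₂ | no e₃ = contradiction
          (trans (sym odd) (trans (xor-cong⁴ (¬-not e₀) (¬-not e₁) (¬-not e₂) (¬-not e₃)) (four (not c)))) λ ()
    where
    four : ∀ b → b xor (b xor (b xor b)) ≡ false
    four false = refl
    four true  = refl

  -- If the first three sides all change value, the values alternate and sum to zero.
  odd-repeats : ∀ h x → ∮ h x ≡ true → ∃ λ y → OnFace x y × h y ≡ h (ϕ y)
  odd-repeats h x odd
    with h x ≟ᵇ h (ϕ x) | h (ϕ x) ≟ᵇ h (ϕ (ϕ x)) | h (ϕ (ϕ x)) ≟ᵇ h (ϕ (ϕ (ϕ x)))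
  ... | yes e | _     | _     = _ , i₀ , e
  ... | no _  | yes e | _     = _ , i₁ , e
  ... | no _  | no _  | yes e = _ , i₂ , e
  ... | no e₀ | no e₁ | no e₂ = contradiction
          (trans (sym odd) (trans (xor-cong⁴ p q r refl) (alternating (h (ϕ (ϕ (ϕ x))))))) λ ()
    where
    r = ¬-not e₂
    q = trans (¬-not e₁) (cong not r)
    p = trans (¬-not e₀) (cong not q)

    alternating : ∀ b → not (not (not b)) xor (not (not b) xor (not b xor b)) ≡ false
    alternating false = refl
    alternating true  = refl

-- Guard sets

≤-third : ∀ {a n} → a + a + a ≤ n → a ≤ n / 3
≤-third {a} {n} 3a≤n = subst (_≤ n / 3) (m*n/n≡m a 3) (/-monoˡ-≤ 3 (≤-trans (≤-reflexive (thrice a)) 3a≤n))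
  where
  open +-*-Solver
  thrice : ∀ a → a * 3 ≡ a + a + a
  thrice = solve 1 (λ a → a :* con 3 := a :+ a :+ a) refl

one-of-three-≤-third : ∀ {a b c n} → a + b + c ≤ n → a ≤ n / 3 ⊎ b ≤ n / 3 ⊎ c ≤ n / 3
one-of-three-≤-third {a} {b} {c} sum≤n with ≤-total a b | ≤-total b c | ≤-total a c
... | inj₁ a≤b | _        | inj₁ a≤c = inj₁ (≤-third (≤-trans (+-mono-≤ (+-mono-≤ (≤-refl {a}) a≤b) a≤c) sum≤n))
... | inj₂ b≤a | inj₁ b≤c | _        = inj₂ (inj₁ (≤-third (≤-trans (+-mono-≤ (+-mono-≤ b≤a (≤-refl {b})) b≤c) sum≤n)))
... | inj₁ a≤b | _        | inj₂ c≤a = inj₂ (inj₂ (≤-third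
      (≤-trans (+-mono-≤ (+-mono-≤ c≤a (≤-trans c≤a a≤b)) (≤-refl {c})) sum≤n)))
... | inj₂ b≤a | inj₂ c≤b | _        = inj₂ (inj₂ (≤-third
      (≤-trans (+-mono-≤ (+-mono-≤ (≤-trans c≤b b≤a) c≤b) (≤-refl {c})) sum≤n)))

coloured : {A : Set} → (A → Bool) → Bool → List A → List A
coloured g c = filter (λ x → g x ≟ᵇ c)

length-coloured : ∀ {A : Set} (g : A → Bool) xs →
  length (coloured g false xs) + length (coloured g true xs) ≡ length xs
length-coloured g [] = refl
length-coloured g (x ∷ xs) with g x
... | false = cong suc (length-coloured g xs)
... | true  = trans (+-suc _ _) (cong suc (length-coloured g xs))

guard-colouring : ∀ {n} (G : PlaneGraph n) (u : Fin n → Bool) →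
  (∀ c f → ∃ λ y → face G y ≡ f × u (vertex G y) ≡ c) →
  (∀ f → ∃ λ y → face G y ≡ f × u (vertex G y) ≡ u (vertex G (α G y))) →
  ∃ λ Γ → IsEdgeGuardSet G Γ × length Γ ≤ n / 3
guard-colouring {n} G u both mono
  with maximal-matching (vertex G) (vertex G ∘ α G) (no-loops G) (λ e → u (vertex G e) ≟ᵇ u (vertex G (α G e)))
... | M , U , m , maximal = smallest (one-of-three-≤-third total)
  where
  dart : Fin n → Fin (d G)
  dart w = proj₁ (vertex-surj G w)

  Γ : Bool → List (Fin (d G))
  Γ c = coloured (u ∘ vertex G) c M ++ map dart (coloured u c U)

  incident : ∀ {f w} e → w ≡ vertex G e ⊎ w ≡ vertex G (α G e) → OnBoundary G w f → Guards G f e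
  incident e (inj₁ refl) on = inj₁ on
  incident e (inj₂ refl) on = inj₂ on

  M-guards : IsEdgeGuardSet G M
  M-guards f with mono f
  ... | y , refl , same with Matching.covering m (vertex G y) | Matching.covering m (vertex G (α G y))
  ...   | inj₂ (e , e∈M , end) | _ = lose e∈M (incident e end (y , refl , refl))
  -- The dart `φ G y` shows that the head of `y` lies on the same face.
  ...   | inj₁ _ | inj₂ (e , e∈M , end) = lose e∈M (incident e end (φ G y ,
            sym (Equivalence.from (face-orbit G y (φ G y)) (1 , refl)) ,
            sym (Equivalence.from (vertex-orbit G (α G y) (φ G y)) (1 , refl))))
  ...   | inj₁ y∈U | inj₁ y′∈U = contradiction y′∈U (maximal y same y∈U)

  Γ-guards : ∀ c → IsEdgeGuardSet G (Γ c)
  Γ-guards c f with both c f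
  ... | y , refl , refl with Matching.covering m (vertex G y)
  ...   | inj₁ y∈U = ++⁺ʳ (coloured (u ∘ vertex G) c M) (map⁺ (lose (∈-filter⁺ (λ w → u w ≟ᵇ c) y∈U refl)
            (inj₁ (y , refl , sym (proj₂ (vertex-surj G (vertex G y)))))))
  ...   | inj₂ (e , e∈M , end) = ++⁺ˡ (lose (∈-filter⁺ (λ e → u (vertex G e) ≟ᵇ c) e∈M (colour end))
            (incident e end (y , refl , refl)))
    where
    colour : vertex G y ≡ vertex G e ⊎ vertex G y ≡ vertex G (α G e) → u (vertex G e) ≡ c
    colour (inj₁ eq) = cong u (sym eq)
    -- `Γ c` selects edges by the colour of their tail; edges of `M` are monochromatic, so the head
    -- has it too.
    colour (inj₂ eq) = trans (All.lookup (Matching.edges m) e∈M) (cong u (sym eq))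

  length-Γ : ∀ c → length (Γ c) ≡ length (coloured (u ∘ vertex G) c M) + length (coloured u c U)
  length-Γ c = trans (length-++ (coloured (u ∘ vertex G) c M))
    (cong (length (coloured (u ∘ vertex G) c M) +_) (length-map dart (coloured u c U)))

  total : length (Γ false) + length (Γ true) + length M ≤ n
  total = begin
    length (Γ false) + length (Γ true) + length M
      ≡⟨ cong (_+ length M) (cong₂ _+_ (length-Γ false) (length-Γ true)) ⟩
    (m₀ + u₀) + (m₁ + u₁) + length M
      ≡⟨ solve 5 (λ m₀ u₀ m₁ u₁ l → (m₀ :+ u₀) :+ (m₁ :+ u₁) :+ l := ((m₀ :+ m₁) :+ l) :+ (u₀ :+ u₁))
           refl m₀ u₀ m₁ u₁ (length M) ⟩
    ((m₀ + m₁) + length M) + (u₀ + u₁)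
      ≡⟨ cong₂ (λ x y → (x + length M) + y) (length-coloured (u ∘ vertex G) M) (length-coloured u U) ⟩
    (length M + length M) + length U
      ≤⟨ Matching.size m ⟩
    n ∎
    where
    open ≤-Reasoning
    open +-*-Solver
    m₀ = length (coloured (u ∘ vertex G) false M)
    m₁ = length (coloured (u ∘ vertex G) true M)
    u₀ = length (coloured u false U)
    u₁ = length (coloured u true U)

  smallest : length (Γ false) ≤ n / 3 ⊎ length (Γ true) ≤ n / 3 ⊎ length M ≤ n / 3 →
    ∃ λ Γ → IsEdgeGuardSet G Γ × length Γ ≤ n / 3
  smallest (inj₁ le)        = Γ false , Γ-guards false , le
  smallest (inj₂ (inj₁ le)) = Γ true , Γ-guards true , le
  smallest (inj₂ (inj₂ le)) = M , M-guards , le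

theorem2 : (n : ℕ) (G : PlaneGraph n) → IsQuadrangulation G →
    ∃ λ Γ → IsEdgeGuardSet G Γ × length Γ ≤ n / 3
theorem2 n G quad with any? {F G} (λ _ → yes tt)
-- With no face there is nothing to guard; otherwise a dart of `f₀` serves as root.
... | no none = [] , (λ f → contradiction (f , tt) none) , z≤n
... | yes (f₀ , _) = guard-colouring G u both mono
  where
  open Quadrangulation G quad

  colouring = odd-colouring (proj₁ (face-surj G f₀))

  u : Fin n → Bool
  u = proj₁ colouring

  both : ∀ c f → ∃ λ y → face G y ≡ f × u (vertex G y) ≡ c
  both c f =
    let y , on , eq = odd-attains (u ∘ vertex G) (rep f) (proj₂ colouring f) c
    in y , trans (face-onFace on) (face-rep f) , eq

  mono : ∀ f → ∃ λ y → face G y ≡ f × u (vertex G y) ≡ u (vertex G (α G y))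
  mono f =
    let y , on , eq = odd-repeats (u ∘ vertex G) (rep f) (proj₂ colouring f)
    in y , trans (face-onFace on) (face-rep f) , trans eq (cong u (vertex-ϕ y))
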